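{- Let $\varphi_1$ and $\varphi_2$ be two $\mathbb{T}$-gains on a connected graph $G$ with $n$ vertices and $m$ edges. Let $T$ be a normal spanning tree of $G$ and let $\overrightarrow{C_j(T)}$, $j=1,\dots,m-n+1$, be the directed fundamental cycles in the suitably oriented graph $\overrightarrow{G_T}$. Then $\varphi_1(\overrightarrow{C_j(T)})=\varphi_2(\overrightarrow{C_j(T)})$ for all $j=1,\dots,m-n+1$ if and only if $\varphi_1(\overrightarrow{C})=\varphi_2(\overrightarrow{C})$ for every cycle $C$ of $G$ (with $\overrightarrow{C}$ a directed version of $C$).
   Context: Graphs are finite, simple and undirected. $\mathbb{T}=\{z\in\mathbb{C}:|z|=1\}$. Each edge $e_{st}$ of $G$ gives two oriented edges $\overrightarrow{e_{st}}$ and $\overrightarrow{e_{ts}}$. A $\mathbb{T}$-gain on $G$ is a map $\varphi$ from the set of oriented edges to $\mathbb{T}$ with $\varphi(\overrightarrow{e_{ts}})=\varphi(\overrightarrow{e_{st}})^{ -1}$; $\Phi=(G,\varphi)$ is then a $\mathbb{T}$-gain graph. The gain of a directed cycle $v_1\to v_2\to\cdots\to v_k\to v_1$ is $\varphi(\overrightarrow{e_{12}})\varphi(\overrightarrow{e_{23}})\cdots\varphi(\overrightarrow{e_{k1}})$; the two directions of a cycle have conjugate gains. A rooted spanning tree $T$ with root $v_r$ induces the tree order: $v_x\le v_y$ iff $v_x$ lies on the path in $T$ from $v_r$ to $v_y$. $T$ is a normal spanning tree if any two adjacent vertices of $G$ are comparable in the tree order. The suitably oriented graph $\overrightarrow{G_T}$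 orients each edge $e_{st}$ with $v_s\le v_t$ as $\overrightarrow{e_{st}}$ if $e_{st}\in E(T)$ and as $\overrightarrow{e_{ts}}$ if $e_{st}\notin E(T)$. Each of the $m-n+1$ edges not in $T$ creates a unique cycle with $T$ (a fundamental cycle $C_j(T)$); in $\overrightarrow{G_T}$ each fundamental cycle is a directed cycle, denoted $\overrightarrow{C_j(T)}$ (the directed fundamental cycles). -}

module Defs where

open import Algebra.Bundles using (CommutativeRing; AbelianGroup)
open import Algebra.Structures using (IsCommutativeRing; IsAbelianGroup)
open import Data.Bool.Base using (Bool; T)
open import Data.Fin.Base using (Fin)
open import Data.List.Base using (List; []; _∷_; length)
open import Data.List.Membership.Propositional using (_∈_)
open import Data.List.Relation.Unary.Unique.Propositional using (Unique)
open import Data.Nat.Base as ℕ using (ℕ)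
import Data.Nat.Properties as ℕ
open import Data.Product.Base using (Σ; Σ-syntax; ∃-syntax; _×_; _,_; proj₁; proj₂)
open import Data.Rational.Base as ℚ using (ℚ; 0ℚ; 1ℚ; ½; ∣_∣)
import Data.Rational.Properties as ℚ
open import Data.Rational.Solver using (module +-*-Solver)
open import Data.Sum.Base using (_⊎_; inj₁; inj₂)
open import Level using (0ℓ)
open import Relation.Binary.Construct.Closure.ReflexiveTransitive as Star
  using (Star; ε; _◅_)
open import Relation.Binary.Construct.Intersection using (_∩_)
open import Relation.Binary.Core using (Rel; _⇒_)
open import Relation.Binary.PropositionalEquality
  using (_≡_; refl; sym; trans; cong; cong₂; subst)
open import Relation.Binary.Structures using (IsEquivalence)
open import Relation.Nullary.Negation using (¬_)

------------------------------------------------------------------------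
-- Rational families tending to zero.
-- Convergence is taken along a family of tails: `Tail N i` says that the
-- index i lies beyond N.  It is used for sequences (I = ℕ) and for double
-- sequences (I = ℕ × ℕ).

module Limits (I : Set) (Tail : ℕ → I → Set)
              (anti : ∀ {M N i} → M ℕ.≤ N → Tail N i → Tail M i) where

  Null : (I → ℚ) → Set
  Null h = ∀ δ → 0ℚ ℚ.< δ → ∃[ N ] (∀ i → Tail N i → ∣ h i ∣ ℚ.< δ)

  Bounded : (I → ℚ) → Set
  Bounded h = ∃[ B ] 0ℚ ℚ.< B × ∃[ N ] (∀ i → Tail N i → ∣ h i ∣ ℚ.≤ B)

  null-cong : ∀ {g h} → (∀ i → g i ≡ h i) → Null g → Null h
  null-cong g≡h null-g δ 0<δ with null-g δ 0<δ
  ... | N , small = N , λ i t → subst (λ q → ∣ q ∣ ℚ.< δ) (g≡h i) (small i t)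

  null-0 : ∀ {h} → (∀ i → h i ≡ 0ℚ) → Null h
  null-0 h≡0 δ 0<δ = 0 , λ i _ → subst (λ q → ∣ q ∣ ℚ.< δ) (sym (h≡0 i)) 0<δ

  null-neg : ∀ {h} → Null h → Null (λ i → ℚ.- h i)
  null-neg {h} null-h δ 0<δ with null-h δ 0<δ
  ... | N , small = N , λ i t →
    subst (ℚ._< δ) (sym (ℚ.∣-p∣≡∣p∣ (h i))) (small i t)

  null-+ : ∀ {g h} → Null g → Null h → Null (λ i → g i ℚ.+ h i)
  null-+ {g} {h} null-g null-h δ 0<δ = M ℕ.⊔ N , small
    where
    η = ½ ℚ.* δ
    0<η : 0ℚ ℚ.< η
    0<η = subst (ℚ._< η) (ℚ.*-zeroʳ ½) (ℚ.*-monoʳ-<-pos ½ 0<δ)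
    M = proj₁ (null-g η 0<η)
    N = proj₁ (null-h η 0<η)
    η+η≡δ : η ℚ.+ η ≡ δ
    η+η≡δ = trans (sym (ℚ.*-distribʳ-+ δ ½ ½)) (ℚ.*-identityˡ δ)
    small : ∀ i → Tail (M ℕ.⊔ N) i → ∣ g i ℚ.+ h i ∣ ℚ.< δ
    small i t = ℚ.≤-<-trans (ℚ.∣p+q∣≤∣p∣+∣q∣ (g i) (h i))
      (subst (_ ℚ.<_) η+η≡δ (ℚ.+-mono-<
        (proj₂ (null-g η 0<η) i (anti (ℕ.m≤m⊔n M N) t))
        (proj₂ (null-h η 0<η) i (anti (ℕ.m≤n⊔m M N) t))))

  null-* : ∀ {b h} → Bounded b → Null h → Null (λ i → b i ℚ.* h i)
  null-* {b} {h} (B , 0<B , M , bound) null-h δ 0<δ = M ℕ.⊔ N , small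
    where
    instance
      B-pos : ℚ.Positive B
      B-pos = ℚ.positive 0<B
      B-nonZero : ℚ.NonZero B
      B-nonZero = ℚ.pos⇒nonZero B
      B-nonNeg : ℚ.NonNegative B
      B-nonNeg = ℚ.pos⇒nonNeg B
      B⁻¹-pos : ℚ.Positive (ℚ.1/ B)
      B⁻¹-pos = ℚ.1/pos⇒pos B
    η = (ℚ.1/ B) ℚ.* δ
    0<η : 0ℚ ℚ.< η
    0<η = subst (ℚ._< η) (ℚ.*-zeroʳ (ℚ.1/ B)) (ℚ.*-monoʳ-<-pos (ℚ.1/ B) 0<δ)
    N = proj₁ (null-h η 0<η)
    Bη≡δ : B ℚ.* η ≡ δ
    Bη≡δ = trans (sym (ℚ.*-assoc B (ℚ.1/ B) δ))
          (trans (cong (ℚ._* δ) (ℚ.*-inverseʳ B)) (ℚ.*-identityˡ δ))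
    small : ∀ i → Tail (M ℕ.⊔ N) i → ∣ b i ℚ.* h i ∣ ℚ.< δ
    small i t = begin-strict
      ∣ b i ℚ.* h i ∣      ≡⟨ ℚ.∣p*q∣≡∣p∣*∣q∣ (b i) (h i) ⟩
      ∣ b i ∣ ℚ.* ∣ h i ∣  ≤⟨ ℚ.*-monoʳ-≤-nonNeg ∣ h i ∣ {{ℚ.nonNegative (ℚ.0≤∣p∣ (h i))}}
                               (bound i (anti (ℕ.m≤m⊔n M N) t)) ⟩
      B ℚ.* ∣ h i ∣        <⟨ ℚ.*-monoʳ-<-pos B
                               (proj₂ (null-h η 0<η) i (anti (ℕ.m≤n⊔m M N) t)) ⟩
      B ℚ.* η              ≡⟨ Bη≡δ ⟩
      δ                    ∎
      where open ℚ.≤-Reasoning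

module L₁ = Limits ℕ ℕ._≤_ ℕ.≤-trans
module L₂ = Limits (ℕ × ℕ) (λ N (m , n) → N ℕ.≤ m × N ℕ.≤ n)
                   (λ M≤N (N≤m , N≤n) → ℕ.≤-trans M≤N N≤m , ℕ.≤-trans M≤N N≤n)

------------------------------------------------------------------------
-- Real numbers: Cauchy sequences of rationals modulo null sequences

Cauchy : (ℕ → ℚ) → Set
Cauchy f = L₂.Null (λ (m , n) → f m ℚ.- f n)

record ℝ : Set where
  constructor mkℝ
  field
    seq    : ℕ → ℚ
    cauchy : Cauchy seq
open ℝ public

infix 4 _≈ℝ_
record _≈ℝ_ (x y : ℝ) : Set where
  constructor mk≈
  field difference-null : L₁.Null (λ n → seq x n ℚ.- seq y n)
open _≈ℝ_ public

open +-*-Solver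

private
  pointwise : ∀ {x y} → (∀ n → seq x n ≡ seq y n) → x ≈ℝ y
  pointwise {x} {y} eq = mk≈ (L₁.null-0 λ n →
    trans (cong (ℚ._- seq y n) (eq n)) (ℚ.+-inverseʳ (seq y n)))

  cauchy-bounded : ∀ x → L₁.Bounded (seq x)
  cauchy-bounded x with cauchy x 1ℚ (ℚ.positive⁻¹ 1ℚ)
  ... | N , close = B , 0<B , N , bound
    where
    f = seq x
    B = 1ℚ ℚ.+ ∣ f N ∣
    0<B : 0ℚ ℚ.< B
    0<B = ℚ.+-mono-<-≤ (ℚ.positive⁻¹ 1ℚ) (ℚ.0≤∣p∣ (f N))
    bound : ∀ n → N ℕ.≤ n → ∣ f n ∣ ℚ.≤ B
    bound n N≤n = begin
      ∣ f n ∣                      ≡⟨ cong ∣_∣ (solve 2 (λ a b → a := (a :- b) :+ b) refl (f n) (f N)) ⟩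
      ∣ (f n ℚ.- f N) ℚ.+ f N ∣    ≤⟨ ℚ.∣p+q∣≤∣p∣+∣q∣ (f n ℚ.- f N) (f N) ⟩
      ∣ f n ℚ.- f N ∣ ℚ.+ ∣ f N ∣  ≤⟨ ℚ.+-monoˡ-≤ ∣ f N ∣ (ℚ.<⇒≤ (close (n , N) (N≤n , ℕ.≤-refl))) ⟩
      B                            ∎
      where open ℚ.≤-Reasoning

  bounded-fst : ∀ {f} → L₁.Bounded f → L₂.Bounded (λ (m , n) → f m)
  bounded-fst (B , 0<B , N , bound) = B , 0<B , N , λ (m , _) (N≤m , _) → bound m N≤m

  bounded-snd : ∀ {f} → L₁.Bounded f → L₂.Bounded (λ (m , n) → f n)
  bounded-snd (B , 0<B , N , bound) = B , 0<B , N , λ (_ , n) (_ , N≤n) → bound n N≤n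

-- Opaque, so that comparing two reals never unfolds a convergence proof.
opaque
  const-cauchy : ∀ q → Cauchy (λ _ → q)
  const-cauchy q = L₂.null-0 λ _ → ℚ.+-inverseʳ q

  +-cauchy : ∀ x y → Cauchy (λ n → seq x n ℚ.+ seq y n)
  +-cauchy x y = L₂.null-cong
    (λ (m , n) → solve 4 (λ a b c d → (a :- b) :+ (c :- d) := (a :+ c) :- (b :+ d)) refl
                   (seq x m) (seq x n) (seq y m) (seq y n))
    (L₂.null-+ (cauchy x) (cauchy y))

  neg-cauchy : ∀ x → Cauchy (λ n → ℚ.- seq x n)
  neg-cauchy x = L₂.null-cong
    (λ (m , n) → solve 2 (λ a b → :- (a :- b) := :- a :- :- b) refl (seq x m) (seq x n))
    (L₂.null-neg (cauchy x))

  *-cauchy : ∀ x y → Cauchy (λ n → seq x n ℚ.* seq y n)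
  *-cauchy x y = L₂.null-cong
    (λ (m , n) → solve 4 (λ a b c d → a :* (c :- d) :+ d :* (a :- b) := a :* c :- b :* d) refl
                   (seq x m) (seq x n) (seq y m) (seq y n))
    (L₂.null-+ (L₂.null-* (bounded-fst (cauchy-bounded x)) (cauchy y))
               (L₂.null-* (bounded-snd (cauchy-bounded y)) (cauchy x)))

constℝ : ℚ → ℝ
constℝ q = mkℝ (λ _ → q) (const-cauchy q)

0ℝ 1ℝ : ℝ
0ℝ = constℝ 0ℚ
1ℝ = constℝ 1ℚ

infixl 6 _+ℝ_ _-ℝ_
infixl 7 _*ℝ_
infix  8 -ℝ_

_+ℝ_ : ℝ → ℝ → ℝ
x +ℝ y = mkℝ (λ n → seq x n ℚ.+ seq y n) (+-cauchy x y)

-ℝ_ : ℝ → ℝ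
-ℝ x = mkℝ (λ n → ℚ.- seq x n) (neg-cauchy x)

_-ℝ_ : ℝ → ℝ → ℝ
x -ℝ y = x +ℝ (-ℝ y)

_*ℝ_ : ℝ → ℝ → ℝ
x *ℝ y = mkℝ (λ n → seq x n ℚ.* seq y n) (*-cauchy x y)

≈ℝ-isEquivalence : IsEquivalence _≈ℝ_
≈ℝ-isEquivalence = record
  { refl  = pointwise (λ _ → refl)
  ; sym   = λ {x} {y} (mk≈ p) → mk≈ (L₁.null-cong
      (λ n → solve 2 (λ a b → :- (a :- b) := b :- a) refl (seq x n) (seq y n))
      (L₁.null-neg p))
  ; trans = λ {x} {y} {z} (mk≈ p) (mk≈ q) → mk≈ (L₁.null-cong
      (λ n → solve 3 (λ a b c → (a :- b) :+ (b :- c) := a :- c) refl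
               (seq x n) (seq y n) (seq z n))
      (L₁.null-+ p q))
  }

+ℝ-cong : ∀ {x y u v} → x ≈ℝ y → u ≈ℝ v → x +ℝ u ≈ℝ y +ℝ v
+ℝ-cong {x} {y} {u} {v} (mk≈ p) (mk≈ q) = mk≈ (L₁.null-cong
  (λ n → solve 4 (λ a b c d → (a :- b) :+ (c :- d) := (a :+ c) :- (b :+ d)) refl
           (seq x n) (seq y n) (seq u n) (seq v n))
  (L₁.null-+ p q))

-ℝ-cong : ∀ {x y} → x ≈ℝ y → -ℝ x ≈ℝ -ℝ y
-ℝ-cong {x} {y} (mk≈ p) = mk≈ (L₁.null-cong
  (λ n → solve 2 (λ a b → :- (a :- b) := :- a :- :- b) refl (seq x n) (seq y n))
  (L₁.null-neg p))

*ℝ-cong : ∀ {x y u v} → x ≈ℝ y → u ≈ℝ v → x *ℝ u ≈ℝ y *ℝ v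
*ℝ-cong {x} {y} {u} {v} (mk≈ p) (mk≈ q) = mk≈ (L₁.null-cong
  (λ n → solve 4 (λ a b c d → a :* (c :- d) :+ d :* (a :- b) := a :* c :- b :* d) refl
           (seq x n) (seq y n) (seq u n) (seq v n))
  (L₁.null-+ (L₁.null-* (cauchy-bounded x) q) (L₁.null-* (cauchy-bounded v) p)))

private
  +ℝ-assoc : ∀ x y z → (x +ℝ y) +ℝ z ≈ℝ x +ℝ (y +ℝ z)
  +ℝ-assoc x y z = pointwise λ n → ℚ.+-assoc (seq x n) (seq y n) (seq z n)

  +ℝ-comm : ∀ x y → x +ℝ y ≈ℝ y +ℝ x
  +ℝ-comm x y = pointwise λ n → ℚ.+-comm (seq x n) (seq y n)

  +ℝ-identityˡ : ∀ x → 0ℝ +ℝ x ≈ℝ x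
  +ℝ-identityˡ x = pointwise λ n → ℚ.+-identityˡ (seq x n)

  +ℝ-identityʳ : ∀ x → x +ℝ 0ℝ ≈ℝ x
  +ℝ-identityʳ x = pointwise λ n → ℚ.+-identityʳ (seq x n)

  +ℝ-inverseˡ : ∀ x → (-ℝ x) +ℝ x ≈ℝ 0ℝ
  +ℝ-inverseˡ x = pointwise λ n → ℚ.+-inverseˡ (seq x n)

  +ℝ-inverseʳ : ∀ x → x +ℝ (-ℝ x) ≈ℝ 0ℝ
  +ℝ-inverseʳ x = pointwise λ n → ℚ.+-inverseʳ (seq x n)

  *ℝ-assoc : ∀ x y z → (x *ℝ y) *ℝ z ≈ℝ x *ℝ (y *ℝ z)
  *ℝ-assoc x y z = pointwise λ n → ℚ.*-assoc (seq x n) (seq y n) (seq z n)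

  *ℝ-comm : ∀ x y → x *ℝ y ≈ℝ y *ℝ x
  *ℝ-comm x y = pointwise λ n → ℚ.*-comm (seq x n) (seq y n)

  *ℝ-identityˡ : ∀ x → 1ℝ *ℝ x ≈ℝ x
  *ℝ-identityˡ x = pointwise λ n → ℚ.*-identityˡ (seq x n)

  *ℝ-identityʳ : ∀ x → x *ℝ 1ℝ ≈ℝ x
  *ℝ-identityʳ x = pointwise λ n → ℚ.*-identityʳ (seq x n)

  *ℝ-distribˡ : ∀ x y z → x *ℝ (y +ℝ z) ≈ℝ (x *ℝ y) +ℝ (x *ℝ z)
  *ℝ-distribˡ x y z = pointwise λ n → ℚ.*-distribˡ-+ (seq x n) (seq y n) (seq z n)

  *ℝ-distribʳ : ∀ x y z → (y +ℝ z) *ℝ x ≈ℝ (y *ℝ x) +ℝ (z *ℝ x)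
  *ℝ-distribʳ x y z = pointwise λ n → ℚ.*-distribʳ-+ (seq x n) (seq y n) (seq z n)

ℝ-isCommutativeRing : IsCommutativeRing _≈ℝ_ _+ℝ_ _*ℝ_ -ℝ_ 0ℝ 1ℝ
ℝ-isCommutativeRing = record
  { isRing = record
    { +-isAbelianGroup = record
      { isGroup = record
        { isMonoid = record
          { isSemigroup = record
            { isMagma = record { isEquivalence = ≈ℝ-isEquivalence ; ∙-cong = +ℝ-cong }
            ; assoc   = +ℝ-assoc
            }
          ; identity = +ℝ-identityˡ , +ℝ-identityʳ
          }
        ; inverse = +ℝ-inverseˡ , +ℝ-inverseʳ
        ; ⁻¹-cong = -ℝ-cong
        }
      ; comm = +ℝ-comm
      }
    ; *-cong     = *ℝ-cong
    ; *-assoc    = *ℝ-assoc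
    ; *-identity = *ℝ-identityˡ , *ℝ-identityʳ
    ; distrib    = *ℝ-distribˡ , *ℝ-distribʳ
    }
  ; *-comm = *ℝ-comm
  }

ℝ-commutativeRing : CommutativeRing 0ℓ 0ℓ
ℝ-commutativeRing = record { isCommutativeRing = ℝ-isCommutativeRing }

private
  module R = IsCommutativeRing ℝ-isCommutativeRing

------------------------------------------------------------------------
-- Complex numbers and the unit circle

infixl 7 _*ℂ_
infix  4 _≈ℂ_

record ℂ : Set where
  constructor _+i_
  field
    re im : ℝ
open ℂ public

record _≈ℂ_ (z w : ℂ) : Set where
  constructor _,_
  field
    re≈ : re z ≈ℝ re w
    im≈ : im z ≈ℝ im w
open _≈ℂ_ public

_*ℂ_ : ℂ → ℂ → ℂ
z *ℂ w = (re z *ℝ re w -ℝ im z *ℝ im w) +i (re z *ℝ im w +ℝ im z *ℝ re w)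

1ℂ : ℂ
1ℂ = 1ℝ +i 0ℝ

conj : ℂ → ℂ
conj z = re z +i (-ℝ im z)

∣_∣² : ℂ → ℝ
∣ z ∣² = re z *ℝ re z +ℝ im z *ℝ im z

-- |z| = √(re² + im²) equals 1 exactly when the radicand does.
Circle : Set
Circle = Σ[ z ∈ ℂ ] ∣ z ∣² ≈ℝ 1ℝ

private
  ∣1∣² : ∣ 1ℂ ∣² ≈ℝ 1ℝ
  ∣1∣² = pointwise λ _ → refl

  ∣*∣² : ∀ z w → ∣ z *ℂ w ∣² ≈ℝ ∣ z ∣² *ℝ ∣ w ∣²
  ∣*∣² z w = pointwise λ n →
    solve 4 (λ a b c d →
      (a :* c :- b :* d) :* (a :* c :- b :* d) :+ (a :* d :+ b :* c) :* (a :* d :+ b :* c)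
        := (a :* a :+ b :* b) :* (c :* c :+ d :* d)) refl
      (seq (re z) n) (seq (im z) n) (seq (re w) n) (seq (im w) n)

  ∣conj∣² : ∀ z → ∣ conj z ∣² ≈ℝ ∣ z ∣²
  ∣conj∣² z = pointwise λ n →
    solve 2 (λ a b → a :* a :+ (:- b) :* (:- b) := a :* a :+ b :* b) refl
      (seq (re z) n) (seq (im z) n)

infixl 7 _∙_
infix  8 _⁻¹

_∙_ : Circle → Circle → Circle
(z , ∣z∣) ∙ (w , ∣w∣) = z *ℂ w ,
  R.trans (∣*∣² z w) (R.trans (R.*-cong ∣z∣ ∣w∣) (R.*-identityˡ 1ℝ))

_⁻¹ : Circle → Circle
(z , ∣z∣) ⁻¹ = conj z , R.trans (∣conj∣² z) ∣z∣

1𝕋 : Circle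
1𝕋 = 1ℂ , ∣1∣²

infix 4 _≈_
_≈_ : Rel Circle 0ℓ
z ≈ w = proj₁ z ≈ℂ proj₁ w

private
  *ℂ-comm : ∀ z w → z *ℂ w ≈ℂ w *ℂ z
  *ℂ-comm z w =
      pointwise (λ n → solve 4 (λ a b c d → a :* c :- b :* d := c :* a :- d :* b) refl
        (seq (re z) n) (seq (im z) n) (seq (re w) n) (seq (im w) n))
    , pointwise (λ n → solve 4 (λ a b c d → a :* d :+ b :* c := c :* b :+ d :* a) refl
        (seq (re z) n) (seq (im z) n) (seq (re w) n) (seq (im w) n))

  *ℂ-assoc : ∀ z w v → (z *ℂ w) *ℂ v ≈ℂ z *ℂ (w *ℂ v)
  *ℂ-assoc z w v =
      pointwise (λ n → solve 6 (λ a b c d e f →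
          (a :* c :- b :* d) :* e :- (a :* d :+ b :* c) :* f
            := a :* (c :* e :- d :* f) :- b :* (c :* f :+ d :* e)) refl
        (seq (re z) n) (seq (im z) n) (seq (re w) n) (seq (im w) n) (seq (re v) n) (seq (im v) n))
    , pointwise (λ n → solve 6 (λ a b c d e f →
          (a :* c :- b :* d) :* f :+ (a :* d :+ b :* c) :* e
            := a :* (c :* f :+ d :* e) :+ b :* (c :* e :- d :* f)) refl
        (seq (re z) n) (seq (im z) n) (seq (re w) n) (seq (im w) n) (seq (re v) n) (seq (im v) n))

  *ℂ-identityˡ : ∀ z → 1ℂ *ℂ z ≈ℂ z
  *ℂ-identityˡ z =
      pointwise (λ n → solve 2 (λ a b → con 1ℚ :* a :- con 0ℚ :* b := a) refl
        (seq (re z) n) (seq (im z) n))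
    , pointwise (λ n → solve 2 (λ a b → con 1ℚ :* b :+ con 0ℚ :* a := b) refl
        (seq (re z) n) (seq (im z) n))

  ≈ℂ-trans : ∀ {z w v} → z ≈ℂ w → w ≈ℂ v → z ≈ℂ v
  ≈ℂ-trans (p , q) (p′ , q′) = R.trans p p′ , R.trans q q′

  conj-inverseˡ : ∀ ((z , _) : Circle) → conj z *ℂ z ≈ℂ 1ℂ
  conj-inverseˡ (z , ∣z∣) =
      R.trans (pointwise λ n → solve 2 (λ a b → a :* a :- (:- b) :* b := a :* a :+ b :* b) refl
        (seq (re z) n) (seq (im z) n)) ∣z∣
    , pointwise λ n → solve 2 (λ a b → a :* b :+ (:- b) :* a := con 0ℚ) refl
        (seq (re z) n) (seq (im z) n)

𝕋-isAbelianGroup : IsAbelianGroup _≈_ _∙_ 1𝕋 _⁻¹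
𝕋-isAbelianGroup = record
  { isGroup = record
    { isMonoid = record
      { isSemigroup = record
        { isMagma = record
          { isEquivalence = record
            { refl  = R.refl , R.refl
            ; sym   = λ (p , q) → R.sym p , R.sym q
            ; trans = ≈ℂ-trans
            }
          ; ∙-cong = λ (p , q) (p′ , q′) →
                R.+-cong (R.*-cong p p′) (R.-‿cong (R.*-cong q q′))
              , R.+-cong (R.*-cong p q′) (R.*-cong q p′)
          }
        ; assoc = λ (z , _) (w , _) (v , _) → *ℂ-assoc z w v
        }
      ; identity = (λ (z , _) → *ℂ-identityˡ z)
                 , (λ (z , _) → ≈ℂ-trans (*ℂ-comm z 1ℂ) (*ℂ-identityˡ z))
      }
    ; inverse = conj-inverseˡ
              , (λ z → ≈ℂ-trans (*ℂ-comm (proj₁ z) (conj (proj₁ z))) (conj-inverseˡ z))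
    ; ⁻¹-cong = λ (p , q) → p , R.-‿cong q
    }
  ; comm = λ (z , _) (w , _) → *ℂ-comm z w
  }

𝕋 : AbelianGroup 0ℓ 0ℓ
𝕋 = record { isAbelianGroup = 𝕋-isAbelianGroup }

------------------------------------------------------------------------
-- Graphs

-- A Boolean adjacency matrix makes `Adj u v` proof-irrelevant, so that
-- there is at most one edge between two vertices.
record Graph (n : ℕ) : Set where
  field
    adj     : Fin n → Fin n → Bool
  Adj : Rel (Fin n) 0ℓ
  Adj u v = T (adj u v)
  field
    Adj-sym   : ∀ {u v} → Adj u v → Adj v u
    Adj-irrefl : ∀ {v} → ¬ Adj v v
open Graph public

-- `Star R u v` is the type of walks from u to v along arcs of R.
module _ {n : ℕ} {R : Rel (Fin n) 0ℓ} where

  vertices : ∀ {u v} → Star R u v → List (Fin n)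
  vertices {u} ε       = u ∷ []
  vertices {u} (_ ◅ p) = u ∷ vertices p

  IsPath : ∀ {u v} → Star R u v → Set
  IsPath p = Unique (vertices p)

-- The directed cycle v₁ → v₂ → ⋯ → v_k → v₁ with k ≥ 3 distinct vertices,
-- presented as the path v₁ → ⋯ → v_k together with the arc v_k → v₁.
-- For the symmetric relation `Adj G` these are the cycles of G, each with
-- a chosen direction and starting vertex.
record DirectedCycle {n} (R : Rel (Fin n) 0ℓ) : Set where
  field
    {first last} : Fin n
    path     : Star R first last
    distinct : IsPath path
    closing  : R last first
    length≥3 : 3 ℕ.≤ length (vertices path)
open DirectedCycle public

module _ {n} {R S : Rel (Fin n) 0ℓ} (R⇒S : R ⇒ S) where

  vertices-map : ∀ {u v} (p : Star R u v) → vertices (Star.map R⇒S p) ≡ vertices p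
  vertices-map ε           = refl
  vertices-map (_◅_ {u} _ p) = cong (u ∷_) (vertices-map p)

  mapCycle : DirectedCycle R → DirectedCycle S
  mapCycle C = record
    { path     = Star.map R⇒S (path C)
    ; distinct = subst Unique (sym (vertices-map (path C))) (distinct C)
    ; closing  = R⇒S (closing C)
    ; length≥3 = subst (λ vs → 3 ℕ.≤ length vs) (sym (vertices-map (path C))) (length≥3 C)
    }

Connected : ∀ {n} → Graph n → Set
Connected G = ∀ u v → Star (Adj G) u v

Acyclic : ∀ {n} → Graph n → Set
Acyclic G = ¬ DirectedCycle (Adj G)

------------------------------------------------------------------------
-- 𝕋-gains

record Gain {n} (G : Graph n) : Set where
  field
    φ     : ∀ {u v} → Adj G u v → Circle
    φ-inv : ∀ {u v} (e : Adj G u v) → φ (Adj-sym G e) ≈ φ e ⁻¹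
open Gain public

module _ {n} {G : Graph n} (g : Gain G) where

  walkGain : ∀ {u v} → Star (Adj G) u v → Circle
  walkGain ε       = 1𝕋
  walkGain (e ◅ p) = φ g e ∙ walkGain p

  cycleGain : DirectedCycle (Adj G) → Circle
  cycleGain C = walkGain (path C) ∙ φ g (closing C)

------------------------------------------------------------------------
-- Rooted spanning trees

record RootedSpanningTree {n} (G : Graph n) : Set where
  field
    tree      : Graph n
    subgraph  : Adj tree ⇒ Adj G
    connected : Connected tree
    acyclic   : Acyclic tree
    root      : Fin n

module _ {n} {G : Graph n} (S : RootedSpanningTree G) where
  open RootedSpanningTree S

  TreeOrder : Rel (Fin n) 0ℓ
  TreeOrder x y = Σ[ p ∈ Star (Adj tree) root y ] IsPath p × x ∈ vertices p

  IsNormal : Set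
  IsNormal = ∀ {u v} → Adj G u v → TreeOrder u v ⊎ TreeOrder v u

  -- Tree edges point away from the root, all others towards it.
  SuitablyOriented : Rel (Fin n) 0ℓ
  SuitablyOriented s t = (Adj tree s t × TreeOrder s t)
                       ⊎ ((Adj G s t × ¬ Adj tree s t) × TreeOrder t s)

  -- Either ordering of the end vertices gives the same edge; this duplication is
  -- harmless, as `TreePlus` below is symmetric in them.
  record NonTreeEdge : Set where
    field
      {end₁ end₂} : Fin n
      edge        : Adj G end₁ end₂
      notInTree   : ¬ Adj tree end₁ end₂

  TreePlus : NonTreeEdge → Rel (Fin n) 0ℓ
  TreePlus e x y = Adj tree x y ⊎ (x ≡ end₁ × y ≡ end₂) ⊎ (x ≡ end₂ × y ≡ end₁)
    where open NonTreeEdge e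

  -- The cycle created by adding e to the tree, directed as in the suitably
  -- oriented graph.  It is unique up to the choice of starting vertex.
  DirectedFundamentalCycle : NonTreeEdge → Set
  DirectedFundamentalCycle e = DirectedCycle (TreePlus e ∩ SuitablyOriented)

  SuitablyOriented⇒Adj : SuitablyOriented ⇒ Adj G
  SuitablyOriented⇒Adj (inj₁ (e , _))       = subgraph e
  SuitablyOriented⇒Adj (inj₂ ((e , _) , _)) = e

  underlying : ∀ e → DirectedFundamentalCycle e → DirectedCycle (Adj G)
  underlying e = mapCycle {R = TreePlus e ∩ SuitablyOriented} λ (_ , a) → SuitablyOriented⇒Adj a

{-# OPTIONS --safe #-}

-- Dividing φ₁ by φ₂ reduces the claim to a single gain: if it is trivial on
-- the directed fundamental cycles then it is trivial on every cycle.  An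
-- acyclic graph has trivial gain on closed walks, since deleting backtracks
-- shortens a walk to a path without changing its gain.  A non-tree edge has
-- comparable ends, so the tree path between them closes up to a directed
-- fundamental cycle, and the edge has the gain of that path.  Hence every walk
-- of G has the gain of a tree walk with the same ends.
module Submission where

open import Algebra.Bundles using (Group; AbelianGroup)
import Algebra.Properties.AbelianGroup as AbelianGroupProperties
import Algebra.Properties.Group as GroupProperties
open import Data.Bool.Properties using (T?; T-irrelevant)
open import Data.Fin.Base using (Fin)
open import Data.Fin.Properties using (_≟_)
open import Data.List.Base using (length)
open import Data.List.Membership.DecPropositional using (_∈?_)
open import Data.List.Membership.Propositional using (_∈_)
open import Data.List.Relation.Unary.All as All using (All; []; _∷_)
open import Data.List.Relation.Unary.All.Properties using (¬Any⇒All¬)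
open import Data.List.Relation.Unary.AllPairs using ([]; _∷_)
open import Data.List.Relation.Unary.Any using (here; there)
open import Data.List.Relation.Unary.Unique.Propositional using (Unique)
open import Data.Nat.Base using (ℕ; _≤_; s≤s; z≤n)
open import Data.Product.Base using (Σ-syntax; _×_; _,_; proj₁; proj₂)
open import Data.Sum.Base using (_⊎_; inj₁; inj₂)
open import Function.Bundles using (_⇔_; mk⇔)
open import Level using (0ℓ)
open import Relation.Binary.Construct.Closure.ReflexiveTransitive as Star
  using (Star; ε; _◅_; _◅◅_)
open import Relation.Binary.Construct.Closure.ReflexiveTransitive.Properties
  using (◅◅-assoc)
open import Relation.Binary.Construct.Intersection using (_∩_)
open import Relation.Binary.Core using (Rel; _⇒_)
open import Relation.Binary.PropositionalEquality
  using (_≡_; _≢_; refl; sym; trans; cong; subst)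
import Relation.Binary.Reasoning.Setoid as SetoidReasoning
open import Relation.Nullary.Decidable using (yes; no)
open import Relation.Nullary.Negation using (contradiction; ¬_)
open import Defs hiding (_≈_; _∙_; _⁻¹)

-- Splitting walks and paths at a vertex.

module _ {n : ℕ} {R : Rel (Fin n) 0ℓ} where

  last∈vertices : ∀ {u v} (p : Star R u v) → v ∈ vertices p
  last∈vertices ε       = here refl
  last∈vertices (_ ◅ p) = there (last∈vertices p)

  splitAt : ∀ {u v x} (p : Star R u v) → x ∈ vertices p →
            Σ[ q ∈ Star R u x ] Σ[ r ∈ Star R x v ] p ≡ q ◅◅ r
  splitAt ε         (here refl) = ε , ε , refl
  splitAt p@(_ ◅ _) (here refl) = ε , p , refl
  splitAt (a ◅ p)   (there x∈p) with splitAt p x∈p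
  ... | q , r , refl = a ◅ q , r , refl

  All-prefix : ∀ {P : Fin n → Set} {u x v} (q : Star R u x) (r : Star R x v) →
               All P (vertices (q ◅◅ r)) → All P (vertices q)
  All-prefix ε       ε       (px ∷ _)  = px ∷ []
  All-prefix ε       (_ ◅ _) (px ∷ _)  = px ∷ []
  All-prefix (_ ◅ q) r       (px ∷ ps) = px ∷ All-prefix q r ps

  isPath-prefix : ∀ {u x v} (q : Star R u x) (r : Star R x v) →
                  IsPath (q ◅◅ r) → IsPath q
  isPath-prefix ε       r _             = [] ∷ []
  isPath-prefix (_ ◅ q) r (u∉ ∷ unique) = All-prefix q r u∉ ∷ isPath-prefix q r unique

  isPath-suffix : ∀ {u x v} (q : Star R u x) (r : Star R x v) →
                  IsPath (q ◅◅ r) → IsPath r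
  isPath-suffix ε       r unique       = unique
  isPath-suffix (_ ◅ q) r (_ ∷ unique) = isPath-suffix q r unique

  -- A `DirectedCycle` needs three vertices, so a path with distinct ends can be too short to close
  -- up only when it is a single arc.
  arc-or-long : ∀ {u v} (p : Star R u v) → u ≢ v →
                (Σ[ a ∈ R u v ] p ≡ a ◅ ε) ⊎ 3 ≤ length (vertices p)
  arc-or-long ε               u≢v = contradiction refl u≢v
  arc-or-long (a ◅ ε)         _   = inj₁ (a , refl)
  arc-or-long (_ ◅ _ ◅ ε)     _   = inj₂ (s≤s (s≤s (s≤s z≤n)))
  arc-or-long (_ ◅ _ ◅ _ ◅ _) _   = inj₂ (s≤s (s≤s (s≤s z≤n)))

adjacent-distinct : ∀ {n} (G : Graph n) {u v} → Adj G u v → u ≢ v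
adjacent-distinct G e refl = Adj-irrefl G e

-- Gains in a group: reduction of walks to tree walks.

module GroupGain {c ℓ} (A : Group c ℓ) {n} {G : Graph n}
                 (φ : ∀ {u v} → Adj G u v → Group.Carrier A) where
  open Group A renaming (refl to ≈-refl; sym to ≈-sym; trans to ≈-trans; ε to 1#)
  open GroupProperties A
  open SetoidReasoning setoid

  gain : ∀ {u v} → Star (Adj G) u v → Carrier
  gain ε       = 1#
  gain (e ◅ w) = φ e ∙ gain w

  gainᶜ : DirectedCycle (Adj G) → Carrier
  gainᶜ C = gain (path C) ∙ φ (closing C)

  -- The same edge of `G` is reached through `subgraph` and through `Adj-sym`, with different proofs
  -- of adjacency.
  φ-irrelevant : ∀ {u v} (e f : Adj G u v) → φ e ≈ φ f
  φ-irrelevant e f = reflexive (cong φ (T-irrelevant e f))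

  module _ (φ-inv : ∀ {u v} (e : Adj G u v) → φ (Adj-sym G e) ≈ φ e ⁻¹)
           (S : RootedSpanningTree G) where
    open RootedSpanningTree S

    treeGain : ∀ {u v} → Star (Adj tree) u v → Carrier
    treeGain p = gain (Star.map subgraph p)

    treeGain-◅◅ : ∀ {u x v} (p : Star (Adj tree) u x) (q : Star (Adj tree) x v) →
                  treeGain (p ◅◅ q) ≈ treeGain p ∙ treeGain q
    treeGain-◅◅ ε       q = ≈-sym (identityˡ _)
    treeGain-◅◅ (e ◅ p) q = ≈-trans (∙-congˡ (treeGain-◅◅ p q)) (≈-sym (assoc _ _ _))

    -- The path can only be e traversed backwards, as otherwise e would close it to a cycle.
    backtrack : ∀ {u v} (e : Adj tree u v) (p : Star (Adj tree) v u) → IsPath p →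
                φ (subgraph e) ∙ treeGain p ≈ 1#
    backtrack e p isPath with arc-or-long p (adjacent-distinct tree (Adj-sym tree e))
    ... | inj₂ long = contradiction
          (record { path = p ; distinct = isPath ; closing = e ; length≥3 = long }) acyclic
    ... | inj₁ (f , refl) = begin
          φ (subgraph e) ∙ (φ (subgraph f) ∙ 1#)  ≈⟨ ∙-congˡ (identityʳ _) ⟩
          φ (subgraph e) ∙ φ (subgraph f)         ≈⟨ ∙-congˡ (φ-irrelevant _ _) ⟩
          φ (subgraph e) ∙ φ (Adj-sym G (subgraph e))  ≈⟨ ∙-congˡ (φ-inv _) ⟩
          φ (subgraph e) ∙ φ (subgraph e) ⁻¹      ≈⟨ inverseʳ _ ⟩
          1#                                      ∎

    -- If prepending `e` to the shortened tail repeats `u`, then `e` and the stretch up to that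
    -- occurrence of `u` form a backtrack of trivial gain, which is cut off.
    shorten : ∀ {u v} (w : Star (Adj tree) u v) →
              Σ[ p ∈ Star (Adj tree) u v ] IsPath p × treeGain w ≈ treeGain p
    shorten ε = ε , [] ∷ [] , ≈-refl
    shorten {u} (e ◅ w) with shorten w
    ... | p , isPath , w≈p with _∈?_ _≟_ u (vertices p)
    ...   | no u∉p = e ◅ p , ¬Any⇒All¬ _ u∉p ∷ isPath , ∙-congˡ w≈p
    ...   | yes u∈p with splitAt p u∈p
    ...     | q , r , refl = r , isPath-suffix q r isPath , (begin
              φ (subgraph e) ∙ treeGain w                 ≈⟨ ∙-congˡ w≈p ⟩
              φ (subgraph e) ∙ treeGain (q ◅◅ r)          ≈⟨ ∙-congˡ (treeGain-◅◅ q r) ⟩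
              φ (subgraph e) ∙ (treeGain q ∙ treeGain r)  ≈⟨ assoc _ _ _ ⟨
              φ (subgraph e) ∙ treeGain q ∙ treeGain r    ≈⟨ ∙-congʳ (backtrack e q (isPath-prefix q r isPath)) ⟩
              1# ∙ treeGain r                             ≈⟨ identityˡ _ ⟩
              treeGain r                                  ∎)

    -- A nonempty path cannot return to its start, so a closed walk shortens to `ε`.
    closed-treeGain : ∀ {u} (w : Star (Adj tree) u u) → treeGain w ≈ 1#
    closed-treeGain w with shorten w
    ... | ε     , _        , w≈1 = w≈1
    ... | e ◅ p , u∉p ∷ _ , _   = contradiction refl (All.lookup u∉p (last∈vertices p))

    opposite-treeGain : ∀ {u v} (p : Star (Adj tree) u v) (q : Star (Adj tree) v u) →
                        treeGain p ≈ treeGain q ⁻¹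
    opposite-treeGain p q = inverseˡ-unique _ _
      (≈-trans (≈-sym (treeGain-◅◅ p q)) (closed-treeGain (p ◅◅ q)))

    arc⇒Adj : ∀ {e} → (TreePlus S e ∩ SuitablyOriented S) ⇒ Adj G
    arc⇒Adj (_ , a) = SuitablyOriented⇒Adj S a

    -- `q` accumulates the way from the root: extended by the next arc it is still a prefix of a
    -- path, which witnesses that the arc points away from the root. The equation lets gains and
    -- vertices pass between `r` and its oriented copy.
    orient : ∀ e {u v} (q : Star (Adj tree) root u) (r : Star (Adj tree) u v) →
             IsPath (q ◅◅ r) →
             Σ[ r′ ∈ Star (TreePlus S e ∩ SuitablyOriented S) u v ]
               Star.map (arc⇒Adj {e}) r′ ≡ Star.map subgraph r
    orient e q ε isPath = ε , refl
    orient e {u} q (_◅_ {_} {x} a r) isPath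
      with orient e (q ◅◅ a ◅ ε) r
                  (subst IsPath (sym (◅◅-assoc q (a ◅ ε) r)) isPath)
    ... | r′ , r′≡r = (inj₁ a , inj₁ (a , u≤x)) ◅ r′ , cong (subgraph a ◅_) r′≡r
      where
      u∈ : ∀ {y} (p : Star (Adj tree) y u) → u ∈ vertices (p ◅◅ a ◅ ε)
      u∈ ε       = here refl
      u∈ (_ ◅ p) = there (u∈ p)
      u≤x : TreeOrder S u x
      u≤x = q ◅◅ a ◅ ε
          , isPath-prefix (q ◅◅ a ◅ ε) r (subst IsPath (sym (◅◅-assoc q (a ◅ ε) r)) isPath)
          , u∈ q

    module _ (normal : IsNormal S)
             (trivial : ∀ e (C : DirectedFundamentalCycle S e) →
                        gainᶜ (underlying S e C) ≈ 1#) where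

      -- Since `u` lies on the path from the root to `v`, the rest `r` of that path, followed by `e`
      -- backwards, is a directed fundamental cycle.
      ascending-edge : ∀ {u v} (e : Adj G u v) → ¬ Adj tree u v → TreeOrder S u v →
                       Σ[ r ∈ Star (Adj tree) u v ] treeGain r ≈ φ e
      ascending-edge e e∉T u≤v@(p , isPath , u∈p) with splitAt p u∈p
      ... | q , r , refl = r , (begin
        treeGain r                     ≈⟨ inverseˡ-unique _ _ r∙e⁻¹≈1 ⟩
        φ (Adj-sym G e) ⁻¹             ≈⟨ ⁻¹-cong (φ-inv e) ⟩
        φ e ⁻¹ ⁻¹                      ≈⟨ ⁻¹-involutive _ ⟩
        φ e                            ∎)
        where
        edge : NonTreeEdge S
        edge = record { edge = e ; notInTree = e∉T }
        oriented = orient edge q r isPath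
        r′ = proj₁ oriented
        r′≡r = proj₂ oriented
        vertices≡ : vertices r ≡ vertices r′
        vertices≡ = trans (sym (vertices-map subgraph r))
                   (trans (cong vertices (sym r′≡r))
                          (vertices-map (arc⇒Adj {edge}) r′))
        long : 3 ≤ length (vertices r)
        long with arc-or-long r (adjacent-distinct G e)
        -- A single arc would put the edge into the tree.
        ... | inj₁ (f , _) = contradiction f e∉T
        ... | inj₂ 3≤      = 3≤
        cycle : DirectedFundamentalCycle S edge
        cycle = record
          { path     = r′
          ; distinct = subst Unique vertices≡ (isPath-suffix q r isPath)
          -- The cycle closes from `v` to `u`, against the direction of `e` and towards the root, as
          -- the orientation demands of a non-tree edge.
          ; closing  = inj₂ (inj₂ (refl , refl))
                     , inj₂ ((Adj-sym G e , λ f → e∉T (Adj-sym tree f)) , u≤v)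
          ; length≥3 = subst (λ vs → 3 ≤ length vs) vertices≡ long
          }
        r∙e⁻¹≈1 : treeGain r ∙ φ (Adj-sym G e) ≈ 1#
        r∙e⁻¹≈1 = ≈-trans (∙-congʳ (reflexive (cong gain (sym r′≡r)))) (trivial edge cycle)

      edge-as-treeWalk : ∀ {u v} (e : Adj G u v) →
                         Σ[ r ∈ Star (Adj tree) u v ] treeGain r ≈ φ e
      edge-as-treeWalk {u} {v} e with T? (adj tree u v)
      ... | yes f = f ◅ ε , ≈-trans (identityʳ _) (φ-irrelevant _ _)
      ... | no e∉T with normal e
      ...   | inj₁ u≤v = ascending-edge e e∉T u≤v
      ...   | inj₂ v≤u with ascending-edge (Adj-sym G e) (λ f → e∉T (Adj-sym tree f)) v≤u
      -- `r` runs from `v` to `u`; instead of reversing it, any tree walk back will do, since its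
      -- gain is inverse to that of `r`.
      ...     | r , r≈e⁻¹ = connected u v , (begin
                treeGain (connected u v)  ≈⟨ opposite-treeGain (connected u v) r ⟩
                treeGain r ⁻¹             ≈⟨ ⁻¹-cong (≈-trans r≈e⁻¹ (φ-inv e)) ⟩
                φ e ⁻¹ ⁻¹                 ≈⟨ ⁻¹-involutive _ ⟩
                φ e                       ∎)

      walk-as-treeWalk : ∀ {u v} (w : Star (Adj G) u v) →
                         Σ[ r ∈ Star (Adj tree) u v ] treeGain r ≈ gain w
      walk-as-treeWalk ε = ε , ≈-refl
      walk-as-treeWalk (e ◅ w) with edge-as-treeWalk e | walk-as-treeWalk w
      ... | q , q≈e | r , r≈w = q ◅◅ r , ≈-trans (treeGain-◅◅ q r) (∙-cong q≈e r≈w)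

      -- Replacing the path and the closing edge by tree walks of equal gain leaves a closed tree
      -- walk.
      cycle-trivial : ∀ C → gainᶜ C ≈ 1#
      cycle-trivial C with walk-as-treeWalk (path C) | edge-as-treeWalk (closing C)
      ... | p , p≈path | q , q≈closing = begin
        gainᶜ C                  ≈⟨ ∙-cong p≈path q≈closing ⟨
        treeGain p ∙ treeGain q  ≈⟨ treeGain-◅◅ p q ⟨
        treeGain (p ◅◅ q)        ≈⟨ closed-treeGain (p ◅◅ q) ⟩
        1#                       ∎

-- The quotient of two gains in an abelian group.

module GainQuotient {c ℓ} (A : AbelianGroup c ℓ) {n} {G : Graph n}
                    (φ₁ φ₂ : ∀ {u v} → Adj G u v → AbelianGroup.Carrier A) where
  open AbelianGroup A renaming (refl to ≈-refl; sym to ≈-sym; trans to ≈-trans; ε to 1#)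
  open AbelianGroupProperties A
  open SetoidReasoning setoid

  private
    module Γ₁ = GroupGain group {G = G} φ₁
    module Γ₂ = GroupGain group {G = G} φ₂

  ψ : ∀ {u v} → Adj G u v → Carrier
  ψ e = φ₁ e ∙ φ₂ e ⁻¹

  private
    module Ψ = GroupGain group {G = G} ψ

  -- Commutativity makes division a homomorphism, so `ψ` along a walk is the quotient of the two
  -- walk gains.
  quotient-∙ : ∀ a b c d → (a ∙ b ⁻¹) ∙ (c ∙ d ⁻¹) ≈ (a ∙ c) ∙ (b ∙ d) ⁻¹
  quotient-∙ a b c d = begin
    (a ∙ b ⁻¹) ∙ (c ∙ d ⁻¹)  ≈⟨ assoc _ _ _ ⟩
    a ∙ (b ⁻¹ ∙ (c ∙ d ⁻¹))  ≈⟨ ∙-congˡ (assoc _ _ _) ⟨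
    a ∙ (b ⁻¹ ∙ c ∙ d ⁻¹)    ≈⟨ ∙-congˡ (∙-congʳ (comm _ _)) ⟩
    a ∙ (c ∙ b ⁻¹ ∙ d ⁻¹)    ≈⟨ ∙-congˡ (assoc _ _ _) ⟩
    a ∙ (c ∙ (b ⁻¹ ∙ d ⁻¹))  ≈⟨ assoc _ _ _ ⟨
    (a ∙ c) ∙ (b ⁻¹ ∙ d ⁻¹)  ≈⟨ ∙-congˡ (⁻¹-∙-comm b d) ⟩
    (a ∙ c) ∙ (b ∙ d) ⁻¹     ∎

  ψ-inv : (∀ {u v} (e : Adj G u v) → φ₁ (Adj-sym G e) ≈ φ₁ e ⁻¹) →
          (∀ {u v} (e : Adj G u v) → φ₂ (Adj-sym G e) ≈ φ₂ e ⁻¹) →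
          ∀ {u v} (e : Adj G u v) → ψ (Adj-sym G e) ≈ ψ e ⁻¹
  ψ-inv inv₁ inv₂ e =
    ≈-trans (∙-cong (inv₁ e) (⁻¹-cong (inv₂ e))) (⁻¹-∙-comm (φ₁ e) (φ₂ e ⁻¹))

  gain-ψ : ∀ {u v} (w : Star (Adj G) u v) → Ψ.gain w ≈ Γ₁.gain w ∙ Γ₂.gain w ⁻¹
  gain-ψ ε       = ≈-sym (inverseʳ 1#)
  gain-ψ (e ◅ w) = ≈-trans (∙-congˡ (gain-ψ w)) (quotient-∙ _ _ _ _)

  gainᶜ-ψ : ∀ C → Ψ.gainᶜ C ≈ Γ₁.gainᶜ C ∙ Γ₂.gainᶜ C ⁻¹
  gainᶜ-ψ C = ≈-trans (∙-congʳ (gain-ψ (path C))) (quotient-∙ _ _ _ _)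

  ≈⇒trivial : ∀ C → Γ₁.gainᶜ C ≈ Γ₂.gainᶜ C → Ψ.gainᶜ C ≈ 1#
  ≈⇒trivial C eq = ≈-trans (gainᶜ-ψ C) (x≈y⇒x∙y⁻¹≈ε eq)

  trivial⇒≈ : ∀ C → Ψ.gainᶜ C ≈ 1# → Γ₁.gainᶜ C ≈ Γ₂.gainᶜ C
  trivial⇒≈ C eq = x∙y⁻¹≈ε⇒x≈y _ _ (≈-trans (≈-sym (gainᶜ-ψ C)) eq)

  cycles-agree :
    (∀ {u v} (e : Adj G u v) → φ₁ (Adj-sym G e) ≈ φ₁ e ⁻¹) →
    (∀ {u v} (e : Adj G u v) → φ₂ (Adj-sym G e) ≈ φ₂ e ⁻¹) →
    (S : RootedSpanningTree G) → IsNormal S →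
    (∀ e C → Γ₁.gainᶜ (underlying S e C) ≈ Γ₂.gainᶜ (underlying S e C)) →
    ∀ C → Γ₁.gainᶜ C ≈ Γ₂.gainᶜ C
  cycles-agree inv₁ inv₂ S normal agree C = trivial⇒≈ C
    (Ψ.cycle-trivial (ψ-inv inv₁ inv₂) S normal
      (λ e C → ≈⇒trivial (underlying S e C) (agree e C)) C)

-- Specialisation to the circle group.

open Defs using (_≈_)
open AbelianGroup 𝕋 using ()
  renaming (refl to ≈-refl; sym to ≈-sym; trans to ≈-trans; ∙-cong to ≈-∙-cong)

-- The analogous proofs of _≡_ would compare the proofs of ∣ z ∣² ≈ℝ 1ℝ, which
-- Agda then unfolds; the arguments are explicit because _≈_ ignores these proofs.
module _ {n} {G : Graph n} (g : Gain G) where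
  open GroupGain (AbelianGroup.group 𝕋) {G = G} (φ g)

  gain≈walkGain : ∀ {u v} (w : Star (Adj G) u v) → gain w ≈ walkGain g w
  gain≈walkGain ε       = ≈-refl {1𝕋}
  gain≈walkGain (e ◅ w) = ≈-∙-cong {φ g e} {φ g e} {gain w} {walkGain g w}
    (≈-refl {φ g e}) (gain≈walkGain w)

  gainᶜ≈cycleGain : ∀ C → gainᶜ C ≈ cycleGain g C
  gainᶜ≈cycleGain C =
    ≈-∙-cong {gain (path C)} {walkGain g (path C)} {φ g (closing C)} {φ g (closing C)}
      (gain≈walkGain (path C)) (≈-refl {φ g (closing C)})

theorem3p1 : ∀ {n : ℕ} (G : Graph n) → Connected G →
    (φ₁ φ₂ : Gain G) →
    (S : RootedSpanningTree G) → IsNormal S →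
    (∀ (e : NonTreeEdge S) (C : DirectedFundamentalCycle S e) →
    cycleGain φ₁ (underlying S e C) ≈ cycleGain φ₂ (underlying S e C))
    ⇔
    (∀ (C : DirectedCycle (Adj G)) → cycleGain φ₁ C ≈ cycleGain φ₂ C)
-- The converse is a restriction: every directed fundamental cycle is a cycle of `G`.
theorem3p1 G _ φ₁ φ₂ S normal = mk⇔ forward (λ agree e C → agree (underlying S e C))
  where
  γ₁ γ₂ : DirectedCycle (Adj G) → Circle
  γ₁ = GroupGain.gainᶜ (AbelianGroup.group 𝕋) {G = G} (φ φ₁)
  γ₂ = GroupGain.gainᶜ (AbelianGroup.group 𝕋) {G = G} (φ φ₂)

  from-γ : ∀ C → γ₁ C ≈ γ₂ C → cycleGain φ₁ C ≈ cycleGain φ₂ C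
  from-γ C eq = ≈-trans {cycleGain φ₁ C} {γ₁ C} {cycleGain φ₂ C}
    (≈-sym {γ₁ C} {cycleGain φ₁ C} (gainᶜ≈cycleGain φ₁ C))
    (≈-trans {γ₁ C} {γ₂ C} {cycleGain φ₂ C} eq (gainᶜ≈cycleGain φ₂ C))

  to-γ : ∀ C → cycleGain φ₁ C ≈ cycleGain φ₂ C → γ₁ C ≈ γ₂ C
  to-γ C eq = ≈-trans {γ₁ C} {cycleGain φ₁ C} {γ₂ C} (gainᶜ≈cycleGain φ₁ C)
    (≈-trans {cycleGain φ₁ C} {cycleGain φ₂ C} {γ₂ C} eq
      (≈-sym {γ₂ C} {cycleGain φ₂ C} (gainᶜ≈cycleGain φ₂ C)))

  forward : (∀ e C → cycleGain φ₁ (underlying S e C) ≈ cycleGain φ₂ (underlying S e C)) →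
            ∀ C → cycleGain φ₁ C ≈ cycleGain φ₂ C
  forward agree C = from-γ C
    (GainQuotient.cycles-agree 𝕋 {G = G} (φ φ₁) (φ φ₂) (φ-inv φ₁) (φ-inv φ₂) S normal
      (λ e D → to-γ (underlying S e D) (agree e D)) C)
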